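{- For the complete bipartite graphs $K_{3,n}$, one has $\mathrm{tpw}(K_{3,n})\le 3$ for all $n\geq 1$, and $\mathrm{tcw}(K_{3,n})=\Theta(\sqrt n)$.
   Context: Graphs are finite, simple and undirected. A tree-partition of a graph $G=(V,E)$ is a pair $(T,(B_i)_{i\in V(T)})$ where $T$ is a tree, $B_i\subseteq V$, for each $v\in V$ there is a unique $i(v)\in V(T)$ with $v\in B_{i(v)}$, and for every edge $uv\in E$ either $i(u)=i(v)$ or $i(u)i(v)\in E(T)$. Its width is $\max_i|B_i|$, and the tree-partition-width $\mathrm{tpw}(G)$ is the minimum width of a tree-partition of $G$. A tree-cut decomposition $(T,\mathcal X)$ of $G$ consists of a rooted tree $T$ and a family $\mathcal X=(X_i)_{i\in V(T)}$ of bags forming a near partition of $V(G)$ (bags may be empty; the nonempty bags form a partition of $V(G)$). Edges of $G$ may join vertices in arbitrary bags. For $e\in E(T)$, with $T_1,T_2$ the two components of $T-e$, $\mathrm{cut}(e)$ is the set of edges of $G$ with one endpoint in $\bigcup_{i\in V(T_1)}X_i$ and the other in $\bigcup_{i\in V(T_2)}X_i$. For a non-root node $t$, $e(t)$ is the edge of $T$ between $t$ and its parent, and the adhesion is $\mathrm{adh}(t)=|\mathrm{cut}(e(t))|$ (the root has adhesion $0$). The torso-size is $\mathrm{tor}(t)=|X_t|+b_t$, where $b_t$ is the number of edges $e\in E(T)$ incident to $t$ with $|\mathrm{cut}(e)|\ge 3$. The width of the decomposition is $\max_{t\in V(T)}\max\{\mathrm{adh}(t),\mathrm{tor}(t)\}$,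 and the tree-cut width $\mathrm{tcw}(G)$ is the minimum width of a tree-cut decomposition of $G$. -}

module Defs where

open import Level using (0ℓ)
open import Data.Empty using (⊥)
open import Data.Fin using (Fin; splitAt)
open import Data.Fin.Properties using (_≟_)
open import Data.List using (List; []; _∷_; length; map; filter; allFin; cartesianProduct)
open import Data.List.Extrema.Nat using (max)
open import Data.List.Membership.Propositional using (_∈_)
open import Data.List.Membership.Propositional.Properties
  using (∈-filter⁺; ∈-filter⁻; ∈-cartesianProduct⁺; ∈-allFin)
open import Data.List.Relation.Unary.Any using (here; there)
open import Data.List.Relation.Unary.Unique.Propositional using (Unique)
open import Data.Nat using (ℕ; _+_; _*_; _^_; _≤_; _<_; _≤?_; _⊔_)
open import Data.Product using (Σ-syntax; ∃-syntax; _×_; _,_; proj₁; proj₂)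
open import Data.Sum using (_⊎_; inj₁; inj₂)
open import Data.Unit using (⊤)
open import Relation.Binary.Core using (Rel)
open import Relation.Binary.Definitions using (Decidable; Symmetric; Irreflexive)
open import Relation.Binary.Construct.Closure.ReflexiveTransitive using (Star; ε; _◅_; _◅◅_)
open import Relation.Binary.PropositionalEquality using (_≡_; refl)
open import Relation.Nullary using (¬_; yes; no)
open import Relation.Nullary.Decidable using (_×-dec_; _⊎-dec_; ¬?; map′)
import Relation.Unary as U

------------------------------------------------------------------------
-- Finite simple graphs

record Graph : Set₁ where
  field
    order      : ℕ
    Adj        : Rel (Fin order) 0ℓ
    adj?       : Decidable Adj
    adj-sym    : Symmetric Adj
    adj-irrefl : Irreflexive _≡_ Adj

  Vertex : Set
  Vertex = Fin order

  Walk : Rel Vertex 0ℓ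
  Walk = Star Adj

open Graph using (Vertex)

walkVertices : ∀ {n} {R : Rel (Fin n) 0ℓ} {u v} → Star R u v → List (Fin n)
walkVertices {u = u} ε       = u ∷ []
walkVertices {u = u} (_ ◅ p) = u ∷ walkVertices p

SameEdge : ∀ {n} → Fin n → Fin n → Rel (Fin n) 0ℓ
SameEdge i j x y = (x ≡ i × y ≡ j) ⊎ (x ≡ j × y ≡ i)

deleteEdge : (G : Graph) → Vertex G → Vertex G → Graph
deleteEdge G i j = record
  { order      = order
  ; Adj        = λ x y → Adj x y × ¬ SameEdge i j x y
  ; adj?       = λ x y → adj? x y ×-dec
                   ¬? (((x ≟ i) ×-dec (y ≟ j)) ⊎-dec ((x ≟ j) ×-dec (y ≟ i)))
  ; adj-sym    = λ (a , ne) → adj-sym a , λ where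
                   (inj₁ (p , q)) → ne (inj₂ (q , p))
                   (inj₂ (p , q)) → ne (inj₁ (q , p))
  ; adj-irrefl = λ eq (a , _) → adj-irrefl eq a
  }
  where open Graph G

BipartiteAdj : ∀ {A B : Set} → Rel (A ⊎ B) 0ℓ
BipartiteAdj (inj₁ _) (inj₁ _) = ⊥
BipartiteAdj (inj₁ _) (inj₂ _) = ⊤
BipartiteAdj (inj₂ _) (inj₁ _) = ⊤
BipartiteAdj (inj₂ _) (inj₂ _) = ⊥

bipartiteAdj? : ∀ {A B : Set} → Decidable (BipartiteAdj {A} {B})
bipartiteAdj? (inj₁ _) (inj₁ _) = no λ ()
bipartiteAdj? (inj₁ _) (inj₂ _) = yes _
bipartiteAdj? (inj₂ _) (inj₁ _) = yes _
bipartiteAdj? (inj₂ _) (inj₂ _) = no λ ()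

bipartiteAdj-sym : ∀ {A B : Set} → Symmetric (BipartiteAdj {A} {B})
bipartiteAdj-sym {x = inj₁ _} {inj₂ _} _ = _
bipartiteAdj-sym {x = inj₂ _} {inj₁ _} _ = _

bipartiteAdj-irrefl : ∀ {A B : Set} → Irreflexive _≡_ (BipartiteAdj {A} {B})
bipartiteAdj-irrefl {x = inj₁ _} refl ()
bipartiteAdj-irrefl {x = inj₂ _} refl ()

-- The first m vertices form one side, the last n the other.
completeBipartite : ℕ → ℕ → Graph
completeBipartite m n = record
  { order      = m + n
  ; Adj        = λ x y → BipartiteAdj (splitAt m x) (splitAt m y)
  ; adj?       = λ x y → bipartiteAdj? (splitAt m x) (splitAt m y)
  ; adj-sym    = λ {x} {y} → bipartiteAdj-sym {x = splitAt m x} {splitAt m y}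
  ; adj-irrefl = λ { {x} refl → bipartiteAdj-irrefl {x = splitAt m x} refl }
  }

------------------------------------------------------------------------
-- Trees

Connected : Graph → Set
Connected G = ∀ u v → Graph.Walk G u v

-- A cycle is a path on at least three vertices together with an edge
-- joining its ends.
Acyclic : Graph → Set
Acyclic G = ∀ {u v} (p : Walk u v) →
  Unique (walkVertices p) → 3 ≤ length (walkVertices p) → ¬ Adj v u
  where open Graph G

record IsTree (T : Graph) : Set where
  field
    nonempty  : 0 < Graph.order T
    connected : Connected T
    acyclic   : Acyclic T

------------------------------------------------------------------------
-- Decidability of reachability, needed to count the edges of a cut

-- Reachability along a list of directed edges, each used at most once.
Reach : ∀ {n} → List (Fin n × Fin n) → Rel (Fin n) 0ℓ
Reach []             u v = u ≡ v
Reach ((x , y) ∷ es) u v = Reach es u v ⊎ (Reach es u x × Reach es y v)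

reach? : ∀ {n} (es : List (Fin n × Fin n)) → Decidable (Reach es)
reach? []             u v = u ≟ v
reach? ((x , y) ∷ es) u v = reach? es u v ⊎-dec (reach? es u x ×-dec reach? es y v)

reach-refl : ∀ {n} (es : List (Fin n × Fin n)) {u} → Reach es u u
reach-refl []       = refl
reach-refl (_ ∷ es) = inj₁ (reach-refl es)

reach-step : ∀ {n} (es : List (Fin n × Fin n)) {x y v} →
  (x , y) ∈ es → Reach es y v → Reach es x v
reach-step (_ ∷ es) (here refl) (inj₁ r)       = inj₂ (reach-refl es , r)
reach-step (_ ∷ es) (here refl) (inj₂ (_ , r)) = inj₂ (reach-refl es , r)
reach-step (_ ∷ es) (there m)   (inj₁ r)       = inj₁ (reach-step es m r)
reach-step (_ ∷ es) (there m)   (inj₂ (r , s)) = inj₂ (reach-step es m r , s)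

reach⇒star : ∀ {n} {R : Rel (Fin n) 0ℓ} (es : List (Fin n × Fin n)) →
  (∀ {x y} → (x , y) ∈ es → R x y) → ∀ {u v} → Reach es u v → Star R u v
reach⇒star []       f refl           = ε
reach⇒star (_ ∷ es) f (inj₁ r)       = reach⇒star es (λ m → f (there m)) r
reach⇒star (_ ∷ es) f (inj₂ (r , s)) =
  reach⇒star es (λ m → f (there m)) r ◅◅ (f (here refl) ◅ reach⇒star es (λ m → f (there m)) s)

star? : ∀ {n} {R : Rel (Fin n) 0ℓ} → Decidable R → Decidable (Star R)
star? {n} {R} R? u v = map′ (reach⇒star es sound) star⇒reach (reach? es u v)
  where
  R?′ : U.Decidable (λ (e : Fin n × Fin n) → R (proj₁ e) (proj₂ e))
  R?′ (x , y) = R? x y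

  all = cartesianProduct (allFin n) (allFin n)
  es  = filter R?′ all

  sound : ∀ {x y} → (x , y) ∈ es → R x y
  sound m = proj₂ (∈-filter⁻ R?′ {xs = all} m)

  star⇒reach : ∀ {x y} → Star R x y → Reach es x y
  star⇒reach ε       = reach-refl es
  star⇒reach (r ◅ p) = reach-step es
    (∈-filter⁺ R?′ (∈-cartesianProduct⁺ (∈-allFin _) (∈-allFin _)) r) (star⇒reach p)

------------------------------------------------------------------------
-- Minima

card : ∀ {n} {P : Fin n → Set} → U.Decidable P → ℕ
card {n} P? = length (filter P? (allFin n))

-- m is the minimum of w over all elements of D.
IsMinimumOf : {D : Set₁} → (D → ℕ) → ℕ → Set₁
IsMinimumOf {D} w m = (Σ[ d ∈ D ] w d ≡ m) × (∀ (d : D) → m ≤ w d)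

bagSize : ∀ {n k} → (Fin n → Fin k) → Fin k → ℕ
bagSize bag t = card (λ v → bag v ≟ t)

------------------------------------------------------------------------
-- Tree-partitions

-- The bags are the fibres of the map `index`.
record TreePartition (G : Graph) : Set₁ where
  field
    tree   : Graph
    isTree : IsTree tree
    index  : Vertex G → Vertex tree
    edges  : ∀ {u v} → Graph.Adj G u v →
             index u ≡ index v ⊎ Graph.Adj tree (index u) (index v)

  width : ℕ
  width = max 0 (map (bagSize index) (allFin (Graph.order tree)))

IsTreePartitionWidth : Graph → ℕ → Set₁
IsTreePartitionWidth G = IsMinimumOf {TreePartition G} TreePartition.width

------------------------------------------------------------------------
-- Tree-cut decompositions

module TreeCut (G T : Graph) (bag : Vertex G → Vertex T) where
  open Graph

  -- For an edge ij of the tree T: x lies in the component of T - ij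
  -- that contains i.
  Side : Vertex T → Vertex T → Vertex T → Set
  Side i j x = Walk (deleteEdge T i j) i x

  side? : ∀ i j → U.Decidable (Side i j)
  side? i j x = star? (adj? (deleteEdge T i j)) i x

  -- Each edge of cut(ij) is listed once, as the ordered pair whose first
  -- entry is the endpoint on the side of i.
  cut : Vertex T → Vertex T → List (Vertex G × Vertex G)
  cut i j = filter
    (λ (u , v) → adj? G u v ×-dec (side? i j (bag u) ×-dec side? j i (bag v)))
    (cartesianProduct (allFin (order G)) (allFin (order G)))

  cutSize : Vertex T → Vertex T → ℕ
  cutSize i j = length (cut i j)

  -- p is the parent of t when T is rooted at r: the neighbour of t such
  -- that p and r are in the same component of T - tp.
  Parent : Vertex T → Vertex T → Vertex T → Set
  Parent r t p = Adj T t p × Side p t r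

  parent? : ∀ r t → U.Decidable (Parent r t)
  parent? r t p = adj? T t p ×-dec side? p t r

  -- In a tree the list of parents is empty for t = r, giving adhesion 0,
  -- and a singleton for every other t.
  adh : Vertex T → Vertex T → ℕ
  adh r t = max 0 (map (cutSize t) (filter (parent? r t) (allFin (order T))))

  tor : Vertex T → ℕ
  tor t = bagSize bag t + card (λ s → adj? T t s ×-dec (3 ≤? cutSize t s))

-- X_t is the fibre of `bag` over t; it may be empty.
record TreeCutDecomposition (G : Graph) : Set₁ where
  field
    tree   : Graph
    isTree : IsTree tree
    root   : Vertex tree
    bag    : Vertex G → Vertex tree

  open TreeCut G tree bag

  width : ℕ
  width = max 0 (map (λ t → adh root t ⊔ tor t) (allFin (Graph.order tree)))

IsTreeCutWidth : Graph → ℕ → Set₁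
IsTreeCutWidth G = IsMinimumOf {TreeCutDecomposition G} TreeCutDecomposition.width

------------------------------------------------------------------------
-- Asymptotics

-- f n w reads "f(n) = w".  The condition is √n / c ≤ f(n) ≤ C √n for all
-- large n, with both inequalities squared; since c and C may be enlarged,
-- nothing is lost by taking them to be natural numbers.
IsΘ√ : (ℕ → ℕ → Set₁) → Set₁
IsΘ√ f = ∃[ c ] ∃[ C ] ∃[ N ] (0 < c × 0 < C ×
  (∀ n → N ≤ n → ∃[ w ] (f n w × n ≤ (c * w) ^ 2 × w ^ 2 ≤ C ^ 2 * n)))

{-# OPTIONS --safe #-}

-- tpw(K_{3,n}) is 1, 2 or 3 according as n = 1, n = 2 or n ≥ 3.  Lower bound:
-- if two right vertices lie in distinct bags, then K_{2,2} → T can only be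
-- realised by folding it onto an edge, which forces a third vertex into one of
-- its two bags; so either all left or all right vertices share a bag, or some
-- bag has three vertices anyway.
--
-- For n ≥ 6, tcw(K_{3,n}) is the least w with n ≤ (w ∸ 3) * (w / 3).  An edge of
-- T separating two left vertices has a cut of size at least n, so at width
-- w < n all left vertices share a bag X_t.  A component of T - t with m right
-- vertices gives a cut of size 3m ≤ w, and the torso-size of t leaves room for
-- at most w - 3 right vertices in X_t and nonempty components together.
-- Conversely, a star with w - 3 leaves holding w / 3 right vertices each has
-- width at most w.

module Submission where

open import Defs
open import Data.Empty using (⊥)
open import Data.Fin
  using (Fin; zero; suc; splitAt; _↑ˡ_; _↑ʳ_; inject≤; combine; quotient; remainder)
open import Data.Fin.Properties
  using (_≟_; splitAt-↑ˡ; splitAt-↑ʳ; ↑ˡ-injective; ↑ʳ-injective; inject≤-injective;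
         combine-remQuot)
open import Data.List
  using (List; []; _∷_; [_]; _++_; length; map; filter; allFin; cartesianProduct; concatMap)
open import Data.List.Extrema.Nat using (max; max≤v⁺; xs≤max)
open import Data.List.Membership.Propositional using (_∈_; lose)
open import Data.List.Membership.Propositional.Properties
  using (∈-filter⁺; ∈-filter⁻; ∈-cartesianProduct⁺; ∈-cartesianProduct⁻; ∈-allFin; ∈-∃++;
         ∈-++⁻; ∈-++⁺ˡ; ∈-++⁺ʳ; ∈-map⁺; ∈-map⁻; ∈-concatMap⁺)
open import Data.List.Properties using (length-map; length-++; length-tabulate)
open import Data.List.Relation.Binary.Subset.Propositional using (_⊆_)
open import Data.List.Relation.Unary.All as All using (All; []; _∷_)
import Data.List.Relation.Unary.All.Properties as All
open import Data.List.Relation.Unary.AllPairs using ([]; _∷_)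
open import Data.List.Relation.Unary.Any using (here; there)
open import Data.List.Relation.Unary.Unique.Propositional using (Unique)
import Data.List.Relation.Unary.Unique.Propositional.Properties as Unique
open import Data.Nat
  using (ℕ; zero; suc; _+_; _*_; _∸_; _^_; _/_; _%_; _≤_; _<_; _≤?_; _⊔_;
         z≤n; s≤s; s≤s⁻¹; >-nonZero)
open import Data.Nat.DivMod
  using (m*n/n≡m; m/n*n≤m; /-monoˡ-≤; m≥n⇒m/n>0; m≡m%n+[m/n]*n; m%n<n; m/n≤m)
open import Data.Nat.Properties hiding (_≟_)
open import Data.Nat.Tactic.RingSolver using (solve-∀)
open import Data.Product using (∃-syntax; _×_; _,_; proj₁; proj₂; swap)
open import Data.Sum using (_⊎_; inj₁; inj₂; [_,_]′)
open import Relation.Binary.Construct.Closure.ReflexiveTransitive using (ε; _◅_; _◅◅_)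
open import Relation.Binary.PropositionalEquality hiding ([_])
open import Relation.Nullary using (¬_; yes; no; contradiction)
open import Relation.Nullary.Decidable using (_×-dec_)
import Relation.Unary as U

open Graph using (Vertex)

-- Lists

-- Each element of `xs` is charged to one occurrence in `ys`, which is then removed; having no
-- repetitions, the rest of `xs` survives the removal. `ys` itself may repeat elements.
length-⊆ : ∀ {A : Set} {xs ys : List A} → Unique xs → xs ⊆ ys → length xs ≤ length ys
length-⊆ {xs = []}     _        _  = z≤n
length-⊆ {xs = x ∷ xs} (x∉ ∷ u) xs⊆ys with ∈-∃++ (xs⊆ys (here refl))
... | as , bs , refl = begin
  suc (length xs)              ≤⟨ s≤s (length-⊆ u drop) ⟩
  suc (length (as ++ bs))      ≡⟨ cong suc (length-++ as) ⟩
  suc (length as + length bs)  ≡⟨ +-suc (length as) (length bs) ⟨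
  length as + suc (length bs)  ≡⟨ length-++ as ⟨
  length (as ++ x ∷ bs)        ∎
  where
  open ≤-Reasoning
  drop : xs ⊆ as ++ bs
  drop m with ∈-++⁻ as (xs⊆ys (there m))
  ... | inj₁ p           = ∈-++⁺ˡ p
  ... | inj₂ (here refl) = contradiction refl (All.lookup x∉ m)
  ... | inj₂ (there p)   = ∈-++⁺ʳ as p

length-cartesianProduct : ∀ {A B : Set} (xs : List A) (ys : List B) →
  length (cartesianProduct xs ys) ≡ length xs * length ys
length-cartesianProduct []       ys = refl
length-cartesianProduct (x ∷ xs) ys = trans (length-++ (map (x ,_) ys))
  (cong₂ _+_ (length-map (x ,_) ys) (length-cartesianProduct xs ys))

length-concatMap-≤ : ∀ {A B : Set} {f : A → List B} {s} xs →
  (∀ {x} → x ∈ xs → length (f x) ≤ s) → length (concatMap f xs) ≤ length xs * s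
length-concatMap-≤ []               f≤s = z≤n
length-concatMap-≤ {f = f} (x ∷ xs) f≤s = subst (_≤ _) (sym (length-++ (f x)))
  (+-mono-≤ (f≤s (here refl)) (length-concatMap-≤ xs (λ m → f≤s (there m))))

length-allFin : ∀ n → length (allFin n) ≡ n
length-allFin n = length-tabulate {n = n} (λ i → i)

∈⇒≤max : ∀ {A : Set} (f : A → ℕ) {x xs} → x ∈ xs → f x ≤ max 0 (map f xs)
∈⇒≤max f {xs = xs} m = All.lookup (xs≤max 0 (map f xs)) (∈-map⁺ f m)

max-map≤ : ∀ {A : Set} (f : A → ℕ) xs {m} → (∀ {x} → x ∈ xs → f x ≤ m) → max 0 (map f xs) ≤ m
max-map≤ f xs f≤m = max≤v⁺ z≤n (All.map⁺ (All.tabulate f≤m))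

module _ {n} {P : Fin n → Set} (P? : U.Decidable P) where

  ≤card : ∀ {xs} → Unique xs → All P xs → length xs ≤ card P?
  ≤card u ps = length-⊆ u λ m → ∈-filter⁺ P? (∈-allFin _) (All.lookup ps m)

  -- The injection allows counting in another type, as `bagSize-leaf` does through `embed`.
  card≤ : ∀ {A : Set} (f : Fin n → A) → (∀ {i j} → f i ≡ f j → i ≡ j) →
          ∀ {ys} → (∀ i → P i → f i ∈ ys) → card P? ≤ length ys
  card≤ f inj {ys} f∈ = begin
    card P?                                ≡⟨ length-map f (filter P? (allFin n)) ⟨
    length (map f (filter P? (allFin n)))  ≤⟨ length-⊆ (Unique.map⁺ inj unique) sub ⟩
    length ys                              ∎
    where
    open ≤-Reasoning
    unique = Unique.filter⁺ P? (Unique.allFin⁺ n)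
    sub : map f (filter P? (allFin n)) ⊆ ys
    sub m with ∈-map⁻ f m
    ... | i , i∈ , refl = f∈ i (proj₂ (∈-filter⁻ P? {xs = allFin n} i∈))

isMinimumOf : ∀ {D : Set₁} (f : D → ℕ) {m} (d : D) → f d ≤ m → (∀ d → m ≤ f d) → IsMinimumOf f m
isMinimumOf f d fd≤m m≤f = (d , ≤-antisym fd≤m (m≤f d)) , m≤f

-- Complete bipartite graphs

module _ {m n : ℕ} where

  left : Fin m → Fin (m + n)
  left i = i ↑ˡ n

  right : Fin n → Fin (m + n)
  right j = m ↑ʳ j

  left≢right : ∀ {i j} → left i ≢ right j
  left≢right {i} {j} e
    with trans (sym (splitAt-↑ˡ m i n)) (trans (cong (splitAt m) e) (splitAt-↑ʳ m n j))
  ... | ()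

  open Graph (completeBipartite m n) using (Adj; adj-sym)

  left-right : ∀ i j → Adj (left i) (right j)
  left-right i j rewrite splitAt-↑ˡ m i n | splitAt-↑ʳ m n j = _

  right-left : ∀ j i → Adj (right j) (left i)
  right-left j i = adj-sym {x = left i} {right j} (left-right i j)

star-isTree : ∀ k → IsTree (completeBipartite 1 k)
star-isTree k = record
  { nonempty = s≤s z≤n
  ; connected = λ u v → to-centre u ◅◅ from-centre v
  ; acyclic = acyclic
  }
  where
  open Graph (completeBipartite 1 k) using (Walk)
  to-centre : ∀ u → Walk u zero
  to-centre zero    = ε
  to-centre (suc _) = _ ◅ ε
  from-centre : ∀ u → Walk zero u
  from-centre zero    = ε
  from-centre (suc _) = _ ◅ ε

  end∈ : ∀ {u v} (p : Walk u v) → v ∈ walkVertices p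
  end∈ ε       = here refl
  end∈ (_ ◅ p) = there (end∈ p)

  start∈ : ∀ {u v} (p : Walk u v) → u ∈ walkVertices p
  start∈ ε       = here refl
  start∈ (_ ◅ p) = here refl

  -- Every edge meets the centre. A walk from the centre is back there after two steps. A path from
  -- a leaf has the centre as its second vertex, and the closing edge makes the centre its last
  -- vertex as well.
  acyclic : Acyclic (completeBipartite 1 k)
  acyclic ε _ (s≤s ())
  acyclic (_ ◅ ε) _ (s≤s (s≤s ()))
  acyclic {zero}  (_◅_ {j = suc _} _ (_◅_ {j = zero} _ p)) ((_ ∷ h) ∷ _) _ _ =
    All.lookup h (start∈ p) refl
  acyclic {suc _} {zero} (_◅_ {j = zero} _ (_ ◅ p)) (_ ∷ h ∷ _) _ _ =
    All.lookup h (end∈ p) refl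

-- Tree-partition-width

module _ {T : Graph} (acyclic : Acyclic T) where
  open Graph T using (Adj; adj-sym; adj-irrefl)

  adj⇒≢ : ∀ {x y} → Adj x y → x ≢ y
  adj⇒≢ a e = adj-irrefl e a

  no-triangle : ∀ {x y z} → Adj x y → Adj y z → ¬ Adj z x
  no-triangle xy yz zx = acyclic (xy ◅ yz ◅ ε)
    ((adj⇒≢ xy ∷ ≢-sym (adj⇒≢ zx) ∷ []) ∷ (adj⇒≢ yz ∷ []) ∷ [] ∷ [])
    (s≤s (s≤s (s≤s z≤n))) zx

  no-4-cycle : ∀ {x y z w} → x ≢ z → y ≢ w → Adj x y → Adj y z → Adj z w → ¬ Adj w x
  no-4-cycle x≢z y≢w xy yz zw wx = acyclic (xy ◅ yz ◅ zw ◅ ε)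
    ((adj⇒≢ xy ∷ x≢z ∷ ≢-sym (adj⇒≢ wx) ∷ []) ∷ (adj⇒≢ yz ∷ y≢w ∷ []) ∷ (adj⇒≢ zw ∷ []) ∷
     [] ∷ [])
    (s≤s (s≤s (s≤s z≤n))) wx

  _~_ : Vertex T → Vertex T → Set
  x ~ y = x ≡ y ⊎ Adj x y

  -- The four relations close up around x, y, x′, y′. Without an equality they form a 4-cycle of the
  -- tree, with exactly one a triangle; two consecutive equalities identify x with x′ or y with y′.
  -- So two opposite relations are equalities.
  folded-4-cycle : ∀ {x x′ y y′} → x ≢ x′ → y ≢ y′ → x ~ y → x ~ y′ → x′ ~ y → x′ ~ y′ →
    (x ≡ y × x′ ≡ y′) ⊎ (x ≡ y′ × x′ ≡ y)
  folded-4-cycle x≢ y≢ (inj₁ p) _ _ (inj₁ q) = inj₁ (p , q)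
  folded-4-cycle x≢ y≢ _ (inj₁ p) (inj₁ q) _ = inj₂ (p , q)
  folded-4-cycle x≢ y≢ (inj₁ refl) (inj₁ refl) _ _ = contradiction refl y≢
  folded-4-cycle x≢ y≢ (inj₁ refl) _ (inj₁ refl) _ = contradiction refl x≢
  folded-4-cycle x≢ y≢ _ (inj₁ refl) _ (inj₁ refl) = contradiction refl x≢
  folded-4-cycle x≢ y≢ _ _ (inj₁ refl) (inj₁ refl) = contradiction refl y≢
  folded-4-cycle x≢ y≢ (inj₁ refl) (inj₂ a) (inj₂ b) (inj₂ c) =
    contradiction (adj-sym a) (no-triangle (adj-sym b) c)
  folded-4-cycle x≢ y≢ (inj₂ a) (inj₁ refl) (inj₂ b) (inj₂ c) =
    contradiction (adj-sym a) (no-triangle (adj-sym c) b)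
  folded-4-cycle x≢ y≢ (inj₂ a) (inj₂ b) (inj₁ refl) (inj₂ c) =
    contradiction (adj-sym b) (no-triangle a c)
  folded-4-cycle x≢ y≢ (inj₂ a) (inj₂ b) (inj₂ c) (inj₁ refl) =
    contradiction (adj-sym a) (no-triangle b c)
  folded-4-cycle x≢ y≢ (inj₂ a) (inj₂ b) (inj₂ c) (inj₂ d) =
    contradiction (adj-sym b) (no-4-cycle x≢ y≢ a (adj-sym c) d)

≤tpWidth : ∀ {G} (D : TreePartition G) → let open TreePartition D in
  ∀ {t xs} → Unique xs → All (λ v → index v ≡ t) xs → length xs ≤ width
≤tpWidth D {t} u ps = ≤-trans (≤card (λ v → index v ≟ t) u ps) (∈⇒≤max (bagSize index) (∈-allFin t))
  where open TreePartition D

module _ {n : ℕ} (D : TreePartition (completeBipartite 3 n)) where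
  open TreePartition D
  open IsTree isTree using (acyclic)

  private
    a : Fin 3 → Fin (3 + n)
    a = left {3} {n}
    a₀ = a zero
    a₁ = a (suc zero)
    a₂ = a (suc (suc zero))

    fold : ∀ {i i′ b b′} →
      index (a i) ≢ index (a i′) → index (right {3} b) ≢ index (right {3} b′) →
      (index (a i) ≡ index (right b) × index (a i′) ≡ index (right b′)) ⊎
      (index (a i) ≡ index (right b′) × index (a i′) ≡ index (right b))
    fold {i} {i′} {b} {b′} x≢ y≢ = folded-4-cycle {tree} acyclic x≢ y≢
      (edge i b) (edge i b′) (edge i′ b) (edge i′ b′)
      where
      edge : ∀ i b → index (a i) ≡ index (right b) ⊎ Graph.Adj tree (index (a i)) (index (right b))
      edge i b = edges {a i} {right b} (left-right i b)

    two-left-one-right : ∀ b i i′ → i ≢ i′ → index (a i) ≡ index (right b) →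
      index (a i′) ≡ index (right b) → 3 ≤ width
    two-left-one-right b i i′ i≢i′ p q = ≤tpWidth D {xs = a i ∷ a i′ ∷ right b ∷ []}
      (((λ e → i≢i′ (↑ˡ-injective n i i′ e)) ∷ left≢right {3} {n} {i} {b} ∷ []) ∷
       (left≢right {3} {n} {i′} {b} ∷ []) ∷ [] ∷ [])
      (p ∷ q ∷ refl ∷ [])

  -- By `fold`, left vertices in distinct bags occupy the bags of b and b′, one each. Three left
  -- vertices thus either share one bag or put two of their number together with a right vertex.
  separated-rights : ∀ {b b′} → index (right b) ≢ index (right b′) → 3 ≤ width
  separated-rights {b} {b′} y≢ with index a₀ ≟ index a₁ | index a₂ ≟ index a₀
  ... | yes p | yes q = ≤tpWidth D {xs = a₀ ∷ a₁ ∷ a₂ ∷ []}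
    (((λ ()) ∷ (λ ()) ∷ []) ∷ ((λ ()) ∷ []) ∷ [] ∷ []) (refl ∷ sym p ∷ q ∷ [])
  ... | yes p | no q with fold q y≢
  ...   | inj₁ (_ , e) = two-left-one-right b′ zero (suc zero) (λ ()) e (trans (sym p) e)
  ...   | inj₂ (_ , e) = two-left-one-right b zero (suc zero) (λ ()) e (trans (sym p) e)
  separated-rights {b} {b′} y≢ | no p | yes q with fold p y≢
  ...   | inj₁ (e , _) = two-left-one-right b zero (suc (suc zero)) (λ ()) e (trans q e)
  ...   | inj₂ (e , _) = two-left-one-right b′ zero (suc (suc zero)) (λ ()) e (trans q e)
  -- The two folds must agree on the bag of `a₀`; the other of the two bags then holds `a₁`, `a₂`
  -- and a right vertex.
  separated-rights {b} {b′} y≢ | no p | no q with fold p y≢ | fold q y≢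
  ... | inj₁ (e , _) | inj₁ (_ , h) = contradiction (trans (sym e) h) y≢
  ... | inj₁ (_ , f) | inj₂ (g , _) = two-left-one-right b′ (suc zero) (suc (suc zero)) (λ ()) f g
  ... | inj₂ (_ , f) | inj₁ (g , _) = two-left-one-right b (suc zero) (suc (suc zero)) (λ ()) f g
  ... | inj₂ (e , _) | inj₂ (_ , h) = contradiction (trans (sym h) e) y≢

tpWidth-K₃₁ : (D : TreePartition (completeBipartite 3 1)) → 1 ≤ TreePartition.width D
tpWidth-K₃₁ D = ≤tpWidth D {xs = zero ∷ []} ([] ∷ []) (refl ∷ [])

tpWidth-K₃₂ : (D : TreePartition (completeBipartite 3 2)) → 2 ≤ TreePartition.width D
tpWidth-K₃₂ D with index (right {3} zero) ≟ index (right {3} (suc zero))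
  where open TreePartition D
... | yes p = ≤tpWidth D {xs = right {3} zero ∷ right {3} (suc zero) ∷ []}
  (((λ ()) ∷ []) ∷ [] ∷ []) (p ∷ refl ∷ [])
... | no p  = ≤-trans (n≤1+n 2) (separated-rights D p)

tpWidth-K₃ₙ : ∀ {n} (D : TreePartition (completeBipartite 3 (3 + n))) → 3 ≤ TreePartition.width D
tpWidth-K₃ₙ D with index b₀ ≟ index b₁ | index b₀ ≟ index b₂
  where
  open TreePartition D
  b₀ = right {3} zero
  b₁ = right {3} (suc zero)
  b₂ = right {3} (suc (suc zero))
... | yes p | yes q = ≤tpWidth D (((λ ()) ∷ (λ ()) ∷ []) ∷ ((λ ()) ∷ []) ∷ [] ∷ []) (refl ∷ sym p ∷ sym q ∷ [])
... | no p  | _     = separated-rights D p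
... | yes _ | no q  = separated-rights D q

starPartition : ∀ {m n k} (f : Fin m ⊎ Fin n → Fin (1 + k)) →
  (∀ x y → BipartiteAdj x y → f x ≡ f y ⊎ Graph.Adj (completeBipartite 1 k) (f x) (f y)) →
  TreePartition (completeBipartite m n)
starPartition {m} {k = k} f edges = record
  { tree   = completeBipartite 1 k
  ; isTree = star-isTree k
  ; index  = λ v → f (splitAt m v)
  ; edges  = λ {u} {v} → edges (splitAt m u) (splitAt m v)
  }

-- For m = 3 and n = 1 or 2 the largest bag has n vertices, which improves on the 3 of
-- `leftsCentred`.
rightsCentred : ∀ m n → TreePartition (completeBipartite m n)
rightsCentred m n = starPartition (λ { (inj₁ i) → suc i ; (inj₂ _) → zero })
  λ { (inj₁ _) (inj₂ _) _ → inj₂ _ ; (inj₂ _) (inj₁ _) _ → inj₂ _ }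

leftsCentred : ∀ m n → TreePartition (completeBipartite m n)
leftsCentred m n = starPartition (λ { (inj₁ _) → zero ; (inj₂ j) → suc j })
  λ { (inj₁ _) (inj₂ _) _ → inj₂ _ ; (inj₂ _) (inj₁ _) _ → inj₂ _ }

width-leftsCentred : ∀ n → TreePartition.width (leftsCentred 3 n) ≤ 3
width-leftsCentred n = max-map≤ (bagSize index) (allFin (1 + n)) λ {t} _ → bag≤ t
  where
  open TreePartition (leftsCentred 3 n)
  bag≤ : ∀ t → bagSize index t ≤ 3
  bag≤ zero = card≤ (λ v → index v ≟ zero) (λ v → v) (λ e → e) {map left (allFin 3)} λ where
    zero            _ → here refl
    (suc zero)        _ → there (here refl)
    (suc (suc zero))  _ → there (there (here refl))
    (suc (suc (suc _))) ()
  bag≤ (suc j) = ≤-trans (card≤ (λ v → index v ≟ suc j) (λ v → v) (λ e → e) {[ right j ]} (λ where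
    zero ()
    (suc zero) ()
    (suc (suc zero)) ()
    (suc (suc (suc _))) refl → here refl)) (s≤s z≤n)

tpw-K₃₁ : IsTreePartitionWidth (completeBipartite 3 1) 1
tpw-K₃₁ = (rightsCentred 3 1 , refl) , tpWidth-K₃₁

tpw-K₃₂ : IsTreePartitionWidth (completeBipartite 3 2) 2
tpw-K₃₂ = (rightsCentred 3 2 , refl) , tpWidth-K₃₂

tpw-K₃ₙ : ∀ n → IsTreePartitionWidth (completeBipartite 3 (3 + n)) 3
tpw-K₃ₙ n = isMinimumOf TreePartition.width
  (leftsCentred 3 (3 + n)) (width-leftsCentred (3 + n)) tpWidth-K₃ₙ

-- `IsTreePartitionWidth` asks for the exact minimum, so a tree-partition of width at most 3 is not
-- enough and the small cases are settled separately.
tpw≤3 : ∀ n → 1 ≤ n → ∃[ k ] (IsTreePartitionWidth (completeBipartite 3 n) k × k ≤ 3)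
tpw≤3 1                   _ = 1 , tpw-K₃₁ , s≤s z≤n
tpw≤3 2                   _ = 2 , tpw-K₃₂ , s≤s (s≤s z≤n)
tpw≤3 (suc (suc (suc n))) _ = 3 , tpw-K₃ₙ n , ≤-refl

-- Tree-cut width

module _ (G T : Graph) (bag : Vertex G → Vertex T) where
  open TreeCut G T bag
  open Graph T using (Walk; adj-sym)

  private
    pairs = cartesianProduct (allFin (Graph.order G)) (allFin (Graph.order G))

    InCut : Vertex T → Vertex T → Vertex G × Vertex G → Set
    InCut i j (u , v) = Graph.Adj G u v × (Side i j (bag u) × Side j i (bag v))

    inCut? : ∀ i j → U.Decidable (InCut i j)
    inCut? i j (u , v) = Graph.adj? G u v ×-dec (side? i j (bag u) ×-dec side? j i (bag v))

  ∈cut⁺ : ∀ {i j u v} → Graph.Adj G u v → Side i j (bag u) → Side j i (bag v) → (u , v) ∈ cut i j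
  ∈cut⁺ {i} {j} a s t =
    ∈-filter⁺ (inCut? i j) (∈-cartesianProduct⁺ (∈-allFin _) (∈-allFin _)) (a , s , t)

  ∈cut⁻ : ∀ {i j u v} → (u , v) ∈ cut i j → Graph.Adj G u v × Side i j (bag u) × Side j i (bag v)
  ∈cut⁻ {i} {j} m = proj₂ (∈-filter⁻ (inCut? i j) {xs = pairs} m)

  cut-unique : ∀ i j → Unique (cut i j)
  cut-unique i j = Unique.filter⁺ (inCut? i j)
    (Unique.cartesianProduct⁺ (Unique.allFin⁺ _) (Unique.allFin⁺ _))

  cutSize-swap : ∀ i j → cutSize i j ≤ cutSize j i
  cutSize-swap i j = begin
    cutSize i j                   ≡⟨ length-map swap (cut i j) ⟨
    length (map swap (cut i j))   ≤⟨ length-⊆ (Unique.map⁺ (cong swap) (cut-unique i j)) sub ⟩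
    cutSize j i                   ∎
    where
    open ≤-Reasoning
    sub : map swap (cut i j) ⊆ cut j i
    sub m with ∈-map⁻ swap m
    ... | (u , v) , uv∈ , refl with ∈cut⁻ uv∈
    ...   | a , s , t = ∈cut⁺ (Graph.adj-sym G a) t s

  -- Induction along the walk: an edge leaving a vertex other than i and j is not the deleted one,
  -- so that vertex inherits the side of its successor.
  some-side : ∀ {u} i j → Walk u i → Side i j u ⊎ Side j i u
  some-side i j ε = inj₁ ε
  some-side {u} i j (a ◅ p) with u ≟ i | u ≟ j | some-side i j p
  ... | yes refl | _        | _      = inj₁ ε
  ... | no _     | yes refl | _      = inj₂ ε
  ... | no u≢i   | no u≢j   | inj₁ s = inj₁ (s ◅◅
    ((adj-sym a , λ { (inj₁ (_ , e)) → u≢j e ; (inj₂ (_ , e)) → u≢i e }) ◅ ε))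
  ... | no u≢i   | no u≢j   | inj₂ s = inj₂ (s ◅◅
    ((adj-sym a , λ { (inj₁ (_ , e)) → u≢i e ; (inj₂ (_ , e)) → u≢j e }) ◅ ε))

  -- The same induction. A vertex whose successor on the walk is t is itself the neighbour z; any
  -- earlier vertex inherits z, unless it is t.
  branch : ∀ {u} t → Walk u t → u ≡ t ⊎ ∃[ z ] (Graph.Adj T t z × Side z t u)
  branch t ε = inj₁ refl
  branch {u} t (a ◅ p) with branch t p
  ... | inj₁ refl = inj₂ (u , adj-sym a , ε)
  ... | inj₂ (z , tz , s) with u ≟ t | u ≟ z
  ...   | yes e  | _        = inj₁ e
  ...   | no _   | yes refl = inj₂ (z , tz , ε)
  ...   | no u≢t | no u≢z   = inj₂ (z , tz , s ◅◅
    ((adj-sym a , λ { (inj₁ (_ , e)) → u≢t e ; (inj₂ (_ , e)) → u≢z e }) ◅ ε))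

module _ {G : Graph} (D : TreeCutDecomposition G) where
  open TreeCutDecomposition D
  open TreeCut G tree bag
  open IsTree isTree using (connected)

  private
    node : Vertex tree → ℕ
    node t = adh root t ⊔ tor t

  tor≤width : ∀ t → tor t ≤ width
  tor≤width t = ≤-trans (m≤n⊔m (adh root t) (tor t)) (∈⇒≤max node (∈-allFin t))

  parent-cutSize≤width : ∀ {t p} → Parent root t p → cutSize t p ≤ width
  parent-cutSize≤width {t} {p} par = begin
    cutSize t p   ≤⟨ ∈⇒≤max (cutSize t) (∈-filter⁺ (parent? root t) (∈-allFin p) par) ⟩
    adh root t    ≤⟨ m≤m⊔n (adh root t) (tor t) ⟩
    node t        ≤⟨ ∈⇒≤max node (∈-allFin t) ⟩
    width         ∎
    where open ≤-Reasoning

  -- The width sees a cut only as the adhesion of the child. Which end of ij is the child depends on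
  -- the side of the root; if it is j, the cut is read in reverse.
  cutSize≤width : ∀ {i j} → Graph.Adj tree i j → cutSize i j ≤ width
  cutSize≤width {i} {j} a = [ (λ σ → parent-cutSize≤width (a , σ))
    , (λ σ → ≤-trans (cutSize-swap G tree bag i j) (parent-cutSize≤width (Graph.adj-sym tree a , σ)))
    ]′ (some-side G tree bag j i (connected root j))

  width≤ : ∀ {w} → (∀ t → adh root t ≤ w) → (∀ t → tor t ≤ w) → width ≤ w
  width≤ adh≤ tor≤ = max-map≤ node (allFin (Graph.order tree)) λ {t} _ → ⊔-lub (adh≤ t) (tor≤ t)

-- Lower bound on tree-cut width: cuts and torsos in a decomposition of K_{m,n}

module _ {m n : ℕ} (D : TreeCutDecomposition (completeBipartite m n)) where
  open TreeCutDecomposition D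
  open TreeCut (completeBipartite m n) tree bag
  open IsTree isTree using (connected)

  private
    G = completeBipartite m n

    a : Fin m → Fin (m + n)
    a = left {m} {n}

    b : Fin n → Fin (m + n)
    b = right {m} {n}

  -- Every right vertex lies on one of the two sides and is adjacent to the left vertex on the
  -- other. This gives one cut edge per right vertex, listed with its endpoint on the side of p
  -- first, as `cut` requires.
  cut-of-separated-lefts : ∀ {i i′ p q} → Side p q (bag (a i)) → Side q p (bag (a i′)) → n ≤ cutSize p q
  cut-of-separated-lefts {i} {i′} {p} {q} s s′ = begin
    n                             ≡⟨ length-allFin n ⟨
    length (allFin n)             ≡⟨ length-map edge (allFin n) ⟨
    length (map edge (allFin n))  ≤⟨ length-⊆ unique sub ⟩
    cutSize p q                   ∎
    where
    open ≤-Reasoning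

    side : ∀ j → Side p q (bag (b j)) ⊎ Side q p (bag (b j))
    side j = some-side G tree bag p q (connected _ _)

    edge : Fin n → Vertex G × Vertex G
    edge j with side j
    ... | inj₁ _ = b j , a i′
    ... | inj₂ _ = a i , b j

    edge∈ : ∀ j → edge j ∈ cut p q
    edge∈ j with side j
    ... | inj₁ t = ∈cut⁺ G tree bag (right-left j i′) t s′
    ... | inj₂ t = ∈cut⁺ G tree bag (left-right i j) s t

    edge-injective : ∀ j k → edge j ≡ edge k → j ≡ k
    edge-injective j k e with side j | side k
    ... | inj₁ _ | inj₁ _ = ↑ʳ-injective m j k (cong proj₁ e)
    ... | inj₁ _ | inj₂ _ = contradiction (sym (cong proj₁ e)) (left≢right {m} {n} {i} {j})
    ... | inj₂ _ | inj₁ _ = contradiction (cong proj₁ e) (left≢right {m} {n} {i} {k})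
    ... | inj₂ _ | inj₂ _ = ↑ʳ-injective m j k (cong proj₂ e)

    unique : Unique (map edge (allFin n))
    unique = Unique.map⁺ (λ {j} {k} → edge-injective j k) (Unique.allFin⁺ n)

    sub : map edge (allFin n) ⊆ cut p q
    sub e∈ with ∈-map⁻ edge e∈
    ... | j , _ , refl = edge∈ j

  -- Otherwise the edge from the node of `a i′` towards that of `a i` separates the two vertices,
  -- and its cut has at least n edges.
  lefts-together : width < n → ∀ i i′ → bag (a i) ≡ bag (a i′)
  lefts-together w<n i i′ = [ (λ e → e)
    , (λ (z , adj , σ) → contradiction
        (≤-trans (cut-of-separated-lefts {i} {i′} σ ε) (cutSize≤width D (Graph.adj-sym tree adj)))
        (<⇒≱ w<n))
    ]′ (branch G tree bag (bag (a i′)) (connected (bag (a i)) _))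

  module _ {t} (lefts : ∀ i → bag (a i) ≡ t) where

    -- The list `bs` is arbitrary so that the bound serves twice: for all right vertices of a branch
    -- it limits their number, and for a single one, with m = 3, it shows that the branch counts in
    -- the torso-size.
    cut-of-branch : ∀ {z bs} → Unique bs → All (λ j → Side z t (bag (b j))) bs →
      length bs * m ≤ cutSize z t
    cut-of-branch {z} {bs} u sides = begin
      length bs * m
        ≡⟨ cong₂ _*_ (length-map b bs) (trans (length-map a (allFin m)) (length-allFin m)) ⟨
      length (map b bs) * length as
        ≡⟨ length-cartesianProduct (map b bs) as ⟨
      length (cartesianProduct (map b bs) as)
        ≤⟨ length-⊆ (Unique.cartesianProduct⁺ (Unique.map⁺ (↑ʳ-injective m _ _) u)
                       (Unique.map⁺ (↑ˡ-injective n _ _) (Unique.allFin⁺ m))) sub ⟩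
      cutSize z t ∎
      where
      open ≤-Reasoning
      as = map a (allFin m)
      sub : cartesianProduct (map b bs) as ⊆ cut z t
      sub {x , y} xy∈ with ∈-cartesianProduct⁻ (map b bs) as xy∈
      ... | x∈ , y∈ with ∈-map⁻ b x∈ | ∈-map⁻ a y∈
      ...   | j , j∈ , refl | i , _ , refl = ∈cut⁺ G tree bag (right-left j i)
              (All.lookup sides j∈) (subst (Side t z) (sym (lefts i)) ε)

    rights-here : List (Fin n)
    rights-here = filter (λ j → bag (b j) ≟ t) (allFin n)

    lefts+rights-here≤bagSize : m + length rights-here ≤ bagSize bag t
    lefts+rights-here≤bagSize = begin
      m + length rights-here
        ≡⟨ cong₂ _+_ (trans (length-map a (allFin m)) (length-allFin m)) (length-map b rights-here) ⟨
      length (map a (allFin m)) + length (map b rights-here)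
        ≡⟨ length-++ (map a (allFin m)) ⟨
      length (map a (allFin m) ++ map b rights-here)
        ≤⟨ ≤card (λ v → bag v ≟ t) unique
             (All.++⁺ (All.map⁺ (All.universal lefts _)) (All.map⁺ (All.all-filter _ (allFin n)))) ⟩
      bagSize bag t ∎
      where
      open ≤-Reasoning
      unique : Unique (map a (allFin m) ++ map b rights-here)
      unique = Unique.++⁺ (Unique.map⁺ (↑ˡ-injective n _ _) (Unique.allFin⁺ m))
        (Unique.map⁺ (↑ʳ-injective m _ _) (Unique.filter⁺ _ (Unique.allFin⁺ n)))
        λ (x∈ , y∈) → disjoint (∈-map⁻ a x∈) (∈-map⁻ b y∈)
        where
        disjoint : ∀ {v} → ∃[ i ] (i ∈ allFin m × v ≡ a i) → ∃[ j ] (j ∈ rights-here × v ≡ b j) → ⊥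
        disjoint (i , _ , p) (j , _ , q) = left≢right {m} {n} {i} {j} (trans (sym p) q)

-- The right vertices are covered by the single vertices of `X` and the branches at the nodes of
-- `Z`. The torso-size of t admits at most w - 3 such pieces, and each has at most w / 3 vertices.
lower-bound : ∀ {n} (D : TreeCutDecomposition (completeBipartite 3 n)) →
  let w = TreeCutDecomposition.width D in w < n → n ≤ (w ∸ 3) * (w / 3)
lower-bound {n} D w<n = begin
  n                                          ≡⟨ length-allFin n ⟨
  length (allFin n)                          ≤⟨ length-⊆ (Unique.allFin⁺ n) (λ {j} _ → covered j) ⟩
  length (X ++ concatMap rights-in Z)        ≡⟨ length-++ X ⟩
  length X + length (concatMap rights-in Z)  ≤⟨ +-mono-≤ X≤ (length-concatMap-≤ Z branch-small) ⟩
  length X * s + length Z * s                ≡⟨ *-distribʳ-+ s (length X) (length Z) ⟨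
  (length X + length Z) * s                  ≤⟨ *-monoˡ-≤ s X+Z≤ ⟩
  (w ∸ 3) * s                                ∎
  where
  open ≤-Reasoning
  open TreeCutDecomposition D renaming (width to w)
  open TreeCut (completeBipartite 3 n) tree bag
  open IsTree isTree using (connected)

  G = completeBipartite 3 n
  s = w / 3
  t = bag zero

  lefts : ∀ i → bag (left {3} {n} i) ≡ t
  lefts i = lefts-together D w<n i zero

  X = rights-here D lefts

  heavy? : U.Decidable (λ z → Graph.Adj tree t z × 3 ≤ cutSize t z)
  heavy? z = Graph.adj? tree t z ×-dec (3 ≤? cutSize t z)

  Z = filter heavy? (allFin (Graph.order tree))

  beyond? : ∀ z → U.Decidable (λ j → Side z t (bag (right {3} j)))
  beyond? z j = side? z t (bag (right {3} j))

  rights-in : Vertex tree → List (Fin n)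
  rights-in z = filter (beyond? z) (allFin n)

  branch-small : ∀ {z} → z ∈ Z → length (rights-in z) ≤ s
  branch-small {z} z∈Z = begin
    length (rights-in z)          ≡⟨ m*n/n≡m (length (rights-in z)) 3 ⟨
    length (rights-in z) * 3 / 3  ≤⟨ /-monoˡ-≤ 3 (≤-trans cut≥ (cutSize≤width D (Graph.adj-sym tree tz))) ⟩
    s                             ∎
    where
    tz : Graph.Adj tree t z
    tz = proj₁ (proj₂ (∈-filter⁻ heavy? {xs = allFin _} z∈Z))
    cut≥ : length (rights-in z) * 3 ≤ cutSize z t
    cut≥ = cut-of-branch D lefts
      (Unique.filter⁺ (beyond? z) (Unique.allFin⁺ n)) (All.all-filter (beyond? z) (allFin n))

  covered : ∀ j → j ∈ X ++ concatMap rights-in Z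
  covered j = [ (λ e → ∈-++⁺ˡ (∈-filter⁺ (λ j → bag (right {3} j) ≟ t) (∈-allFin j) e))
    , (λ (z , tz , σ) → ∈-++⁺ʳ X (∈-concatMap⁺ rights-in
        (lose (z∈Z tz σ) (∈-filter⁺ (beyond? z) (∈-allFin j) σ))))
    ]′ (branch G tree bag t (connected (bag (right {3} j)) t))
    where
    -- One right vertex beyond z already sends three edges through the cut, the threshold in the
    -- torso-size.
    z∈Z : ∀ {z} → Graph.Adj tree t z → Side z t (bag (right {3} j)) → z ∈ Z
    z∈Z {z} tz σ = ∈-filter⁺ heavy? (∈-allFin z) (tz ,
      ≤-trans (cut-of-branch D lefts {bs = [ j ]} ([] ∷ []) (σ ∷ [])) (cutSize-swap G tree bag z t))

  3+X+Z≤w : 3 + (length X + length Z) ≤ w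
  3+X+Z≤w = begin
    3 + (length X + length Z)    ≡⟨ +-assoc 3 (length X) (length Z) ⟨
    3 + length X + length Z      ≤⟨ +-monoˡ-≤ (length Z) (lefts+rights-here≤bagSize D lefts) ⟩
    tor t                        ≤⟨ tor≤width D t ⟩
    w                            ∎

  X+Z≤ : length X + length Z ≤ w ∸ 3
  X+Z≤ = ∸-monoˡ-≤ 3 3+X+Z≤w

  -- The bag at t contains the three left vertices, so w is at least 3 and s at least 1: a single
  -- vertex is a piece of size at most s.
  X≤ : length X ≤ length X * s
  X≤ = m≤m*n (length X) s {{>-nonZero (m≥n⇒m/n>0 {w} {3} (m+n≤o⇒m≤o 3 3+X+Z≤w))}}

-- Upper bound on tree-cut width: star decompositions

star-side : ∀ {k} {j : Fin k} {x} →
  Graph.Walk (deleteEdge (completeBipartite 1 k) (suc j) zero) (suc j) x → x ≡ suc j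
star-side ε = refl
-- The only edge at a leaf is the deleted one, so no walk leaves the leaf.
star-side (_◅_ {j = zero} (_ , ne) _) = contradiction (inj₁ (refl , refl)) ne

module _ (n k s : ℕ) (n≤k*s : n ≤ k * s) where

  private
    G = completeBipartite 3 n
    T = completeBipartite 1 k

    lefts : List (Fin (3 + n))
    lefts = map left (allFin 3)

    -- The right vertices become the first n of k * s places, arranged in k consecutive blocks of
    -- length s, one block per leaf. The last blocks may be partly or wholly empty.
    embed : Fin (3 + n) → Fin (3 + k * s)
    embed v = inject≤ v (+-monoʳ-≤ 3 n≤k*s)

    slot : Fin 3 ⊎ Fin (k * s) → Vertex T
    slot (inj₁ _) = zero
    slot (inj₂ c) = suc (quotient {k} s c)

    bag : Vertex G → Vertex T
    bag v = slot (splitAt 3 (embed v))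

  open TreeCut G T bag

  starDecomposition : TreeCutDecomposition G
  starDecomposition = record { tree = T ; isTree = star-isTree k ; root = zero ; bag = bag }

  bagSize-centre : bagSize bag zero ≤ 3
  bagSize-centre = card≤ (λ v → bag v ≟ zero) (λ v → v) (λ e → e) {lefts} λ where
    zero              _ → here refl
    (suc zero)          _ → there (here refl)
    (suc (suc zero))    _ → there (there (here refl))
    (suc (suc (suc _))) ()

  bagSize-leaf : ∀ j → bagSize bag (suc j) ≤ s
  bagSize-leaf j = begin
    bagSize bag (suc j)
      ≤⟨ card≤ (λ v → bag v ≟ suc j) embed (inject≤-injective _ _ _ _) {block} (λ v → in-block (embed v)) ⟩
    length block
      ≡⟨ trans (length-map (λ r → 3 ↑ʳ combine j r) (allFin s)) (length-allFin s) ⟩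
    s ∎
    where
    open ≤-Reasoning
    block : List (Fin (3 + k * s))
    block = map (λ r → 3 ↑ʳ combine j r) (allFin s)

    in-block : ∀ c → slot (splitAt 3 c) ≡ suc j → c ∈ block
    in-block (suc (suc (suc d))) refl = subst (λ c → 3 ↑ʳ c ∈ block) (combine-remQuot {k} s d)
      (∈-map⁺ (λ r → 3 ↑ʳ combine j r) (∈-allFin (remainder {k} s d)))

  -- By `star-side` the far end of a cut edge lies in the bag of the leaf itself. It is then a right
  -- vertex, and the other end is one of the three left vertices.
  cutSize-leaf : ∀ j → cutSize zero (suc j) ≤ 3 * s
  cutSize-leaf j = begin
    cutSize zero (suc j)
      ≤⟨ length-⊆ (cut-unique G T bag zero (suc j)) (λ {uv} → sub {uv}) ⟩
    length (cartesianProduct lefts leaf)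
      ≡⟨ length-cartesianProduct lefts leaf ⟩
    3 * bagSize bag (suc j)
      ≤⟨ *-monoʳ-≤ 3 (bagSize-leaf j) ⟩
    3 * s ∎
    where
    open ≤-Reasoning
    leaf = filter (λ v → bag v ≟ suc j) (allFin (3 + n))

    neighbour-is-left : ∀ u v → Graph.Adj G u v → bag v ≡ suc j → u ∈ lefts
    neighbour-is-left zero              v _ _ = here refl
    neighbour-is-left (suc zero)        v _ _ = there (here refl)
    neighbour-is-left (suc (suc zero))  v _ _ = there (there (here refl))
    neighbour-is-left (suc (suc (suc _))) zero _ ()
    neighbour-is-left (suc (suc (suc _))) (suc zero) _ ()
    neighbour-is-left (suc (suc (suc _))) (suc (suc zero)) _ ()

    sub : cut zero (suc j) ⊆ cartesianProduct lefts leaf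
    sub {u , v} uv∈ with ∈cut⁻ G T bag {zero} {suc j} uv∈
    ... | a , _ , σ = ∈-cartesianProduct⁺ (neighbour-is-left u v a (star-side σ))
                        (∈-filter⁺ (λ v → bag v ≟ suc j) (∈-allFin v) (star-side σ))

  -- The hypotheses correspond in order to the torso-size of the centre, the torso-size of a leaf
  -- and the adhesion of a leaf.
  width-starDecomposition : ∀ {w} → 3 + k ≤ w → s + 1 ≤ w → 3 * s ≤ w →
    TreeCutDecomposition.width starDecomposition ≤ w
  width-starDecomposition {w} 3+k≤w s+1≤w 3*s≤w =
    width≤ starDecomposition adh≤ tor≤
    where
    cutSize≤ : ∀ t p → Graph.Adj T t p → cutSize t p ≤ w
    cutSize≤ zero    (suc j) _ = ≤-trans (cutSize-leaf j) 3*s≤w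
    cutSize≤ (suc j) zero    _ =
      ≤-trans (cutSize-swap G T bag (suc j) zero) (≤-trans (cutSize-leaf j) 3*s≤w)

    adh≤ : ∀ t → adh zero t ≤ w
    adh≤ t = max-map≤ (cutSize t) (filter (parent? zero t) (allFin (1 + k))) λ {p} p∈ →
      cutSize≤ t p (proj₁ (proj₂ (∈-filter⁻ (parent? zero t) {xs = allFin (1 + k)} p∈)))

    heavy? : ∀ t → U.Decidable (λ p → Graph.Adj T t p × 3 ≤ cutSize t p)
    heavy? t p = Graph.adj? T t p ×-dec (3 ≤? cutSize t p)

    tor≤ : ∀ t → tor t ≤ w
    tor≤ zero = ≤-trans (+-mono-≤ bagSize-centre heavy≤) 3+k≤w
      where
      heavy≤ : card (heavy? zero) ≤ k
      heavy≤ = subst (card (heavy? zero) ≤_) (trans (length-map suc (allFin k)) (length-allFin k))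
        (card≤ (heavy? zero) (λ p → p) (λ e → e) {map suc (allFin k)} λ where
          (suc j) _ → ∈-map⁺ suc (∈-allFin j))
    tor≤ (suc j) = ≤-trans (+-mono-≤ (bagSize-leaf j) heavy≤) s+1≤w
      where
      heavy≤ : card (heavy? (suc j)) ≤ 1
      heavy≤ = card≤ (heavy? (suc j)) (λ p → p) (λ e → e) {[ zero ]} λ where
        zero _ → here refl

-- The least width that fits and its growth

Fits : ℕ → ℕ → Set
Fits n w = n ≤ (w ∸ 3) * (w / 3)

fits⇒decomposition : ∀ {n w} → 1 ≤ n → Fits n w →
  ∃[ k ] ∃[ s ] ∃[ n≤ ] TreeCutDecomposition.width (starDecomposition n k s n≤) ≤ w
fits⇒decomposition {n} {w} 1≤n n≤ = w ∸ 3 , s , n≤ ,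
  width-starDecomposition n (w ∸ 3) s n≤ (≤-reflexive (m+[n∸m]≡n 3≤w)) s+1≤w 3*s≤w
  where
  open ≤-Reasoning
  s = w / 3

  3≤w : 3 ≤ w
  -- For w < 3 the truncated difference is 0, and so is the product, against 1 ≤ n.
  3≤w = ≮⇒≥ λ w<3 → contradiction (≤-trans 1≤n n≤)
    (<⇒≱ (subst (λ d → d * s < 1) (sym (m≤n⇒m∸n≡0 (<⇒≤ w<3))) (s≤s z≤n)))

  3*s≤w : 3 * s ≤ w
  3*s≤w = subst (_≤ w) (*-comm s 3) (m/n*n≤m w 3)

  s+1≤w : s + 1 ≤ w
  s+1≤w = begin
    s + 1          ≤⟨ +-monoʳ-≤ s (m≥n⇒m/n>0 3≤w) ⟩
    s + s          ≤⟨ +-monoʳ-≤ s (m≤m+n s (s + 0)) ⟩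
    3 * s          ≤⟨ 3*s≤w ⟩
    w              ∎

least : ∀ {P : ℕ → Set} → U.Decidable P → ∀ m →
  (∃[ w ] (w < m × P w × (∀ {j} → j < w → ¬ P j))) ⊎ (∀ {j} → j < m → ¬ P j)
least P? zero = inj₂ λ ()
least P? (suc m) with least P? m
... | inj₁ (w , w<m , p , min) = inj₁ (w , m<n⇒m<1+n w<m , p , min)
... | inj₂ none with P? m
...   | yes p = inj₁ (m , n<1+n m , p , none)
...   | no ¬p = inj₂ λ { (s≤s j≤m) pj → ¬∃ j≤m pj }
  where
  ¬∃ : ∀ {j} → j ≤ m → ¬ _
  ¬∃ j≤m pj with m≤n⇒m<n∨m≡n j≤m
  ... | inj₁ j<m  = none j<m pj
  ... | inj₂ refl = ¬p pj

-- The source of the threshold 6: from there on n / 3 is at least 2 and 2 * (n - 3) is at least n.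
-- Hence the least w that fits is at most n.
fits-self : ∀ {n} → 6 ≤ n → Fits n n
fits-self {n} 6≤n = begin
  n                    ≡⟨ m+[n∸m]≡n 3≤n ⟨
  3 + (n ∸ 3)          ≤⟨ +-monoˡ-≤ (n ∸ 3) (∸-monoˡ-≤ 3 6≤n) ⟩
  (n ∸ 3) + (n ∸ 3)    ≡⟨ cong ((n ∸ 3) +_) (+-identityʳ (n ∸ 3)) ⟨
  2 * (n ∸ 3)          ≡⟨ *-comm 2 (n ∸ 3) ⟩
  (n ∸ 3) * 2          ≤⟨ *-monoʳ-≤ (n ∸ 3) (/-monoˡ-≤ 3 6≤n) ⟩
  (n ∸ 3) * (n / 3)    ∎
  where
  open ≤-Reasoning
  3≤n : 3 ≤ n
  3≤n = ≤-trans (m≤m+n 3 3) 6≤n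

fits⇒≤square : ∀ {n w} → Fits n w → n ≤ (1 * w) ^ 2
fits⇒≤square {n} {w} n≤ = begin
  n                    ≤⟨ n≤ ⟩
  (w ∸ 3) * (w / 3)    ≤⟨ *-mono-≤ (m∸n≤m w 3) (m/n≤m w 3) ⟩
  w * w                ≡⟨ square w ⟨
  (1 * w) ^ 2          ∎
  where
  open ≤-Reasoning
  square : ∀ w → (1 * w) * ((1 * w) * 1) ≡ w * w
  square = solve-∀

-- If q = 1 + p, then v - 3 is at least 3p, so failure to fit gives n ≥ 1 + 3p(1 + p). Four times
-- this exceeds (2 + p)² by 11p² + 8p; the factor 4 is attained at p = 0.
[1+q]²≤4n : ∀ {n v} → 1 ≤ n → ¬ Fits n v → let q = v / 3 in (1 + q) * (1 + q) ≤ 4 * n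
[1+q]²≤4n {n} {v} 1≤n ¬fits with v / 3 in eq
... | zero  = ≤-trans 1≤n (m≤m+n n (3 * n))
... | suc p = begin
  (2 + p) * (2 + p)                            ≤⟨ m≤m+n _ (11 * (p * p) + 8 * p) ⟩
  (2 + p) * (2 + p) + (11 * (p * p) + 8 * p)   ≡⟨ expand p ⟩
  4 * (1 + p * 3 * (1 + p))
    ≤⟨ *-monoʳ-≤ 4 (≤-trans (s≤s (*-monoˡ-≤ (1 + p) 3p≤v∸3)) (≰⇒> ¬fits)) ⟩
  4 * n                                        ∎
  where
  open ≤-Reasoning
  expand : ∀ p → (2 + p) * (2 + p) + (11 * (p * p) + 8 * p) ≡ 4 * (1 + p * 3 * (1 + p))
  expand = solve-∀
  3p≤v∸3 : p * 3 ≤ v ∸ 3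
  3p≤v∸3 = ∸-monoˡ-≤ 3 (subst (λ q → q * 3 ≤ v) eq (m/n*n≤m v 3))

-- The failure of v = w - 1 bounds w: as w ≤ 3(1 + q) with q = v / 3, its square is at most 9(1 +
-- q)² ≤ 36n.
minimal⇒square≤ : ∀ {n w} → 1 ≤ n → (∀ {v} → v < w → ¬ Fits n v) → w ^ 2 ≤ 6 ^ 2 * n
minimal⇒square≤ {n} {zero}  _   _   = z≤n
minimal⇒square≤ {n} {suc v} 1≤n min = begin
  suc v ^ 2                  ≤⟨ ^-monoˡ-≤ 2 v<3[1+q] ⟩
  (3 * (1 + q)) ^ 2          ≡⟨ square q ⟩
  9 * ((1 + q) * (1 + q))    ≤⟨ *-monoʳ-≤ 9 ([1+q]²≤4n {v = v} 1≤n (min (n<1+n v))) ⟩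
  9 * (4 * n)                ≡⟨ *-assoc 9 4 n ⟨
  6 ^ 2 * n                  ∎
  where
  open ≤-Reasoning
  q = v / 3
  square : ∀ q → (3 * (1 + q)) * ((3 * (1 + q)) * 1) ≡ 9 * ((1 + q) * (1 + q))
  square = solve-∀
  v<3[1+q] : v < 3 * (1 + q)
  v<3[1+q] = begin-strict
    v                  ≡⟨ m≡m%n+[m/n]*n v 3 ⟩
    v % 3 + q * 3      <⟨ +-monoˡ-< (q * 3) (m%n<n v 3) ⟩
    3 + q * 3          ≡⟨ *-comm (1 + q) 3 ⟩
    3 * (1 + q)        ∎

tcw-K₃ₙ : ∀ {n w} → 6 ≤ n → w ≤ n → Fits n w → (∀ {v} → v < w → ¬ Fits n v) →
  IsTreeCutWidth (completeBipartite 3 n) w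
tcw-K₃ₙ {n} {w} 6≤n w≤n fits min =
  let k , s , n≤ , width≤w = fits⇒decomposition (≤-trans (s≤s z≤n) 6≤n) fits
  in isMinimumOf TreeCutDecomposition.width (starDecomposition n k s n≤) width≤w w≤width
  where
  w≤width : (D : TreeCutDecomposition (completeBipartite 3 n)) → w ≤ TreeCutDecomposition.width D
  -- A width below n fits by `lower-bound`, so minimality of w applies; a width of at least n is
  -- covered by w ≤ n.
  w≤width D = [ (λ <n → ≮⇒≥ λ <w → min <w (lower-bound D <n)) , ≤-trans w≤n ]′
    (<-≤-connex (TreeCutDecomposition.width D) n)

tcw-Θ√ : IsΘ√ (λ n → IsTreeCutWidth (completeBipartite 3 n))
-- The constants c, C and N come from `fits⇒≤square`, `minimal⇒square≤` and `fits-self`.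
tcw-Θ√ = 1 , 6 , 6 , s≤s z≤n , s≤s z≤n , bounds
  where
  bounds : ∀ n → 6 ≤ n →
    ∃[ w ] (IsTreeCutWidth (completeBipartite 3 n) w × n ≤ (1 * w) ^ 2 × w ^ 2 ≤ 6 ^ 2 * n)
  bounds n 6≤n =
    [ (λ (w , w<1+n , fits , min) → w , tcw-K₃ₙ 6≤n (s≤s⁻¹ w<1+n) fits min ,
        fits⇒≤square {w = w} fits , minimal⇒square≤ (≤-trans (s≤s z≤n) 6≤n) min)
    , (λ none → contradiction (fits-self 6≤n) (none (n<1+n n)))
    -- The search runs below n + 1 so that n itself, which fits, is included.
    ]′ (least {Fits n} (λ w → n ≤? (w ∸ 3) * (w / 3)) (suc n))

mainTheorem7 : (∀ (n : ℕ) → 1 ≤ n → ∃[ k ] (IsTreePartitionWidth (completeBipartite 3 n) k × k ≤ 3))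
    × IsΘ√ (λ n → IsTreeCutWidth (completeBipartite 3 n))
mainTheorem7 = tpw≤3 , tcw-Θ√
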